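{- Let $n$ be a nonnegative integer. There is a delicate cubefree binary word of length $n$ if and only if $n \in \{20, 21, 22, 29, 33, 34, 35\} \cup \{m \mid m \geq 38\}$.
   Context: Words are finite strings over the binary alphabet $\{0,1\}$. A factor of a word is a contiguous subword. A cube is a word of the form $XXX$ with $X$ a nonempty word; a word is cubefree if none of its factors is a cube. A delicate cubefree word is a nonempty cubefree word such that changing any single one of its letters to the other letter of the alphabet yields a word containing a cube as a factor. -}

module Defs where

open import Data.Bool using (Bool; not)
open import Data.List using (List; []; _∷_; _++_; length)
open import Data.Fin using (Fin; zero; suc)
open import Data.Product using (∃; ∃-syntax; _×_; _,_)
open import Relation.Binary.PropositionalEquality using (_≡_)
open import Relation.Nullary using (¬_)

Word : Set
Word = List Bool

Factor : Word → Word → Set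
Factor f w = ∃[ u ] ∃[ v ] (w ≡ u ++ f ++ v)

IsCube : Word → Set
IsCube c = ∃[ X ] (¬ (X ≡ [])) × (c ≡ X ++ X ++ X)

ContainsCube : Word → Set
ContainsCube w = ∃[ c ] (IsCube c × Factor c w)

CubeFree : Word → Set
CubeFree w = ¬ ContainsCube w

flipAt : (w : Word) → Fin (length w) → Word
flipAt (a ∷ w) zero    = not a ∷ w
flipAt (a ∷ w) (suc i) = a ∷ flipAt w i

Delicate : Word → Set
Delicate w = ¬ (w ≡ []) × CubeFree w × ((i : Fin (length w)) → ContainsCube (flipAt w i))

{-# OPTIONS --safe #-}
-- Existence. Let h₀ be a delicate word of length 22, and let h map 0 to h₀ and 1 to its complement.
-- A concatenation of delicate words still has a cube after every change of a letter, so only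
-- cubefreeness matters. In the fixed point τ of h, occurrences of blocks are aligned to multiples
-- of 22, hence a cube with a period at least 22 has its period divisible by 22 and descends to a
-- shorter cube of τ, while a cube with a smaller period lies in four consecutive blocks. One
-- delicate word of each length 45, …, 66, followed by blocks τ 1, τ 2, …, covers all n ≥ 45.
--
-- Nonexistence. A backtracking search on prefixes of words of length at most 37 discards a prefix
-- that ends in a cube, or that has a letter whose change cannot complete any cube within 37 letters.
module Submission where

open import Defs
open import Agda.Builtin.Char using (primCharToNat)
open import Data.Bool using (Bool; true; false; not; _∧_; _∨_; _xor_; T)
open import Data.Bool.Properties using (T-≡; T-∧; T-∨; xor-assoc; xor-same)
open import Data.Empty using (⊥; ⊥-elim)
open import Data.Fin using (zero; suc; toℕ; fromℕ<)
open import Data.Fin.Properties using (toℕ<n; toℕ-fromℕ<)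
open import Data.List using (List; []; _∷_; _++_; length; map; take; drop; _∷ʳ_)
open import Data.List.Properties using (++-assoc; ++-identityʳ; length-++; length-drop; take++drop≡id)
open import Data.List.Relation.Unary.Any using (here; there)
open import Data.Nat
open import Data.Nat.Divisibility using (n∣m*n)
open import Data.Nat.DivMod
open import Data.Nat.Induction using (<-wellFounded)
open import Data.Nat.Properties
open import Data.Nat.Tactic.RingSolver using (solve-∀)
open import Data.Product using (∃-syntax; _×_; _,_; proj₁; proj₂)
open import Data.String using (String; toList)
open import Data.Sum using (_⊎_; inj₁; inj₂)
open import Data.Unit using (tt)
open import Function.Bundles using (_⇔_; mk⇔; module Equivalence)
open import Induction.WellFounded using (Acc; acc)
open import Relation.Binary.PropositionalEquality
open import Relation.Nullary using (¬_; yes; no; contradiction)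
open import Relation.Nullary.Decidable using (⌊_⌋; toWitness)
open import Data.List.Membership.DecPropositional Data.Nat._≟_ using (_∈_; _∈?_)

open Equivalence using (to; from)

-- Words as sequences, false past the end

at : Word → ℕ → Bool
at []      _       = false
at (a ∷ _) zero    = a
at (_ ∷ w) (suc k) = at w k

at-++ˡ : ∀ u v {k} → k < length u → at (u ++ v) k ≡ at u k
at-++ˡ (a ∷ u) v {zero}  _         = refl
at-++ˡ (a ∷ u) v {suc k} (s≤s k<u) = at-++ˡ u v k<u

at-++ʳ : ∀ u v k → at (u ++ v) (length u + k) ≡ at v k
at-++ʳ []      v k = refl
at-++ʳ (a ∷ u) v k = at-++ʳ u v k

at-drop : ∀ n w k → at (drop n w) k ≡ at w (n + k)
at-drop zero    w       k = refl
at-drop (suc n) []      k = refl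
at-drop (suc n) (a ∷ w) k = at-drop n w k

take-cong : ∀ n {u v} → n ≤ length u → n ≤ length v →
            (∀ k → k < n → at u k ≡ at v k) → take n u ≡ take n v
take-cong zero    _ _ _ = refl
take-cong (suc n) {a ∷ u} {b ∷ v} (s≤s n≤u) (s≤s n≤v) eq =
  cong₂ _∷_ (eq 0 z<s) (take-cong n n≤u n≤v λ k k<n → eq (suc k) (s≤s k<n))

-- Cubes as repetitions

-- A stretch of `3q` letters with period `q`. Stated for sequences, the notion serves both finite
-- words, through `at`, and the infinite word `τ`.
Cube : (ℕ → Bool) → ℕ → ℕ → Set
Cube f s q = ∀ k → k < q + q → f (s + k) ≡ f (s + k + q)

prepend-cube : ∀ u {w} → ContainsCube w → ContainsCube (u ++ w)
prepend-cube u (c , cube , x , y , refl) = c , cube , u ++ x , y , sym (++-assoc u x (c ++ y))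

append-cube : ∀ {w} v → ContainsCube w → ContainsCube (w ++ v)
append-cube v (c , cube , x , y , refl) =
  c , cube , x , y ++ v , trans (++-assoc x (c ++ y) v) (cong (x ++_) (++-assoc c y v))

drop-cube : ∀ n {w} → ContainsCube (drop n w) → ContainsCube w
drop-cube n {w} c = subst ContainsCube (take++drop≡id n w) (prepend-cube (take n w) c)

initial-cube : ∀ q w → 0 < q → q + (q + q) ≤ length w → Cube (at w) 0 q → ContainsCube w
initial-cube q w 0<q 3q≤w cube =
  X ++ X ++ X , (X , X≢[] , refl) , [] , drop q (drop q (drop q w)) , (begin
    w                                        ≡⟨ sym (take++drop≡id q w) ⟩
    X ++ drop q w                            ≡⟨ cong (X ++_) (split (drop q w) X₂) ⟩
    X ++ X ++ drop q (drop q w)              ≡⟨ cong (λ t → X ++ X ++ t) (split (drop q (drop q w)) X₃) ⟩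
    X ++ X ++ X ++ drop q (drop q (drop q w)) ≡⟨ sym (cong (X ++_) (++-assoc X X _)) ⟩
    X ++ (X ++ X) ++ drop q (drop q (drop q w)) ≡⟨ sym (++-assoc X (X ++ X) _) ⟩
    (X ++ X ++ X) ++ drop q (drop q (drop q w)) ∎)
  where
  open ≡-Reasoning
  X = take q w
  l₂ : q + q ≤ length (drop q w)
  l₂ = subst (q + q ≤_) (sym (length-drop q w)) (m+n≤o⇒n≤o∸m q 3q≤w)
    where
    m+n≤o⇒n≤o∸m : ∀ m {n o} → m + n ≤ o → n ≤ o ∸ m
    m+n≤o⇒n≤o∸m m {n} p = subst (_≤ _) (m+n∸m≡n m n) (∸-monoˡ-≤ m p)
  l₃ : q ≤ length (drop q (drop q w))
  l₃ = subst (q ≤_) (sym (length-drop q (drop q w)))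
         (subst (_≤ length (drop q w) ∸ q) (m+n∸m≡n q q) (∸-monoˡ-≤ q l₂))
  X₂ : take q (drop q w) ≡ X
  X₂ = take-cong q (m+n≤o⇒m≤o q l₂) (m+n≤o⇒m≤o q 3q≤w) λ k k<q →
         trans (at-drop q w k) (trans (cong (at w) (+-comm q k)) (sym (cube k (<-≤-trans k<q (m≤m+n q q)))))
  X₃ : take q (drop q (drop q w)) ≡ X
  X₃ = trans (take-cong q l₃ (m+n≤o⇒m≤o q l₂) λ k k<q →
         trans (at-drop q (drop q w) k) (trans (at-drop q w (q + k)) (trans (cong (at w) (+-comm q (q + k)))
           (trans (sym (cube (q + k) (+-monoʳ-< q k<q))) (sym (at-drop q w k))))) ) X₂
  split : ∀ v → take q v ≡ X → v ≡ X ++ drop q v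
  split v eq = trans (sym (take++drop≡id q v)) (cong (_++ drop q v) eq)
  X≢[] : ¬ (X ≡ [])
  X≢[] = nonempty q w 0<q (m+n≤o⇒m≤o q 3q≤w)
    where
    nonempty : ∀ n v → 0 < n → n ≤ length v → ¬ (take n v ≡ [])
    nonempty (suc n) (a ∷ v) _ _ ()

cube⇒containsCube : ∀ s q w → 0 < q → s + (q + (q + q)) ≤ length w → Cube (at w) s q → ContainsCube w
cube⇒containsCube s q w 0<q fits cube =
  drop-cube s (initial-cube q (drop s w) 0<q
    (subst (q + (q + q) ≤_) (sym (length-drop s w))
      (subst (_≤ length w ∸ s) (m+n∸m≡n s _) (∸-monoˡ-≤ s fits)))
    λ k k<2q → trans (at-drop s w k) (trans (cube k k<2q)
      (trans (cong (at w) (+-assoc s k q)) (sym (at-drop s w (k + q))))))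

containsCube⇒cube : ∀ {w} → ContainsCube w →
                    ∃[ s ] ∃[ q ] (0 < q × s + (q + (q + q)) ≤ length w × Cube (at w) s q)
containsCube⇒cube (_ , (X , X≢[] , refl) , u , v , refl) =
  length u , q , positive X X≢[] , fits , cube
  where
  q = length X
  positive : ∀ X → ¬ (X ≡ []) → 0 < length X
  positive []      ne = ⊥-elim (ne refl)
  positive (_ ∷ _) _  = z<s
  fits : length u + (q + (q + q)) ≤ length (u ++ (X ++ X ++ X) ++ v)
  fits rewrite length-++ u {(X ++ X ++ X) ++ v} | length-++ (X ++ X ++ X) {v} | length-++ X {X ++ X} | length-++ X {X} =
    +-monoʳ-≤ (length u) (m≤m+n _ (length v))
  c = (X ++ X ++ X) ++ v
  c≡ : c ≡ X ++ (X ++ X) ++ v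
  c≡ = ++-assoc X (X ++ X) v
  c≡′ : c ≡ (X ++ X) ++ (X ++ v)
  c≡′ = trans c≡ (trans (cong (X ++_) (++-assoc X X v)) (sym (++-assoc X X (X ++ v))))
  cube : Cube (at (u ++ c)) (length u) q
  cube k k<2q = begin
    at (u ++ c) (length u + k)        ≡⟨ at-++ʳ u c k ⟩
    at c k                            ≡⟨ cong (λ z → at z k) c≡′ ⟩
    at ((X ++ X) ++ (X ++ v)) k       ≡⟨ at-++ˡ (X ++ X) (X ++ v) k<XX ⟩
    at (X ++ X) k                     ≡⟨ sym (at-++ˡ (X ++ X) v k<XX) ⟩
    at ((X ++ X) ++ v) k              ≡⟨ sym (at-++ʳ X ((X ++ X) ++ v) k) ⟩
    at (X ++ (X ++ X) ++ v) (q + k)   ≡⟨ cong₂ at (sym c≡) (+-comm q k) ⟩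
    at c (k + q)                      ≡⟨ sym (at-++ʳ u c (k + q)) ⟩
    at (u ++ c) (length u + (k + q))  ≡⟨ cong (at (u ++ c)) (sym (+-assoc (length u) k q)) ⟩
    at (u ++ c) (length u + k + q)    ∎
    where
    open ≡-Reasoning
    k<XX : k < length (X ++ X)
    k<XX = subst (k <_) (sym (length-++ X)) k<2q

-- Changing a letter

toggle : ℕ → Word → Word
toggle _       []      = []
toggle zero    (a ∷ w) = not a ∷ w
toggle (suc i) (a ∷ w) = a ∷ toggle i w

flipAt-toggle : ∀ w i → flipAt w i ≡ toggle (toℕ i) w
flipAt-toggle (a ∷ w) zero    = refl
flipAt-toggle (a ∷ w) (suc i) = cong (a ∷_) (flipAt-toggle w i)

length-toggle : ∀ i w → length (toggle i w) ≡ length w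
length-toggle _       []      = refl
length-toggle zero    (a ∷ w) = refl
length-toggle (suc i) (a ∷ w) = cong suc (length-toggle i w)

at-toggle : ∀ i w {k} → ¬ (k ≡ i) → at (toggle i w) k ≡ at w k
at-toggle _       []      _ = refl
at-toggle zero    (a ∷ w) {zero}  k≢i = ⊥-elim (k≢i refl)
at-toggle zero    (a ∷ w) {suc k} k≢i = refl
at-toggle (suc i) (a ∷ w) {zero}  k≢i = refl
at-toggle (suc i) (a ∷ w) {suc k} k≢i = at-toggle i w λ k≡i → k≢i (cong suc k≡i)

toggle-++ˡ : ∀ i u v → i < length u → toggle i (u ++ v) ≡ toggle i u ++ v
toggle-++ˡ zero    (a ∷ u) v _         = refl
toggle-++ˡ (suc i) (a ∷ u) v (s≤s i<u) = cong (a ∷_) (toggle-++ˡ i u v i<u)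

toggle-++ʳ : ∀ i u v → toggle (length u + i) (u ++ v) ≡ u ++ toggle i v
toggle-++ʳ i []      v = refl
toggle-++ʳ i (a ∷ u) v = cong (a ∷_) (toggle-++ʳ i u v)

-- The part of delicacy that survives concatenation. Cubefreeness does not survive it and is
-- established separately.
Fragile : Word → Set
Fragile w = ∀ i → i < length w → ContainsCube (toggle i w)

-- The changed letter lies in `u` or in `v`, and the cube created there remains a factor of the
-- concatenation.
fragile-++ : ∀ {u v} → Fragile u → Fragile v → Fragile (u ++ v)
fragile-++ {u} {v} fu fv i i<uv with i <? length u
... | yes i<u = subst ContainsCube (sym (toggle-++ˡ i u v i<u)) (append-cube v (fu i i<u))
... | no  i≮u with m≤n⇒∃[o]m+o≡n (≮⇒≥ i≮u)
...   | j , refl = subst ContainsCube (sym (toggle-++ʳ j u v))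
  (prepend-cube u (fv j (+-cancelˡ-< (length u) j (length v) (subst (length u + j <_) (length-++ u) i<uv))))

delicate : ∀ {w} → ¬ (w ≡ []) → CubeFree w → Fragile w → Delicate w
delicate {w} ne cf fr = ne , cf , λ i → subst ContainsCube (sym (flipAt-toggle w i)) (fr (toℕ i) (toℕ<n i))

delicate⇒fragile : ∀ {w} → Delicate w → Fragile w
delicate⇒fragile {w} (_ , _ , fl) i i<w =
  subst ContainsCube (trans (flipAt-toggle w (fromℕ< i<w)) (cong (λ j → toggle j w) (toℕ-fromℕ< i<w))) (fl (fromℕ< i<w))

-- Boolean tests

T-not : ∀ {b} → T (not b) → ¬ T b
T-not {false} _ ()

anyPositive : (ℕ → Bool) → ℕ → Bool
anyPositive P zero    = false
anyPositive P (suc n) = P (suc n) ∨ anyPositive P n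

anyPositive⁺ : ∀ P n {q} → 0 < q → q ≤ n → T (P q) → T (anyPositive P n)
anyPositive⁺ P zero    0<q q≤0 Pq = contradiction (<-≤-trans 0<q q≤0) λ ()
anyPositive⁺ P (suc n) 0<q q≤1+n Pq with m≤n⇒m<n∨m≡n q≤1+n
... | inj₁ (s≤s q≤n) = from T-∨ (inj₂ (anyPositive⁺ P n 0<q q≤n Pq))
... | inj₂ refl      = from T-∨ (inj₁ Pq)

anyPositive⁻ : ∀ P n → T (anyPositive P n) → ∃[ q ] (0 < q × T (P q))
anyPositive⁻ P (suc n) t with to T-∨ t
... | inj₁ Pn = suc n , z<s , Pn
... | inj₂ t′ = anyPositive⁻ P n t′

allBelow : (ℕ → Bool) → ℕ → Bool
allBelow P zero    = true
allBelow P (suc n) = P n ∧ allBelow P n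

allBelow⁺ : ∀ P n → (∀ i → i < n → T (P i)) → T (allBelow P n)
allBelow⁺ P zero    _ = tt
allBelow⁺ P (suc n) h = from T-∧ (h n ≤-refl , allBelow⁺ P n λ i i<n → h i (m<n⇒m<1+n i<n))

allBelow⁻ : ∀ P n → T (allBelow P n) → ∀ i → i < n → T (P i)
allBelow⁻ P (suc n) t i i<1+n with to T-∧ t | m<1+n⇒m<n∨m≡n i<1+n
... | _  , t′ | inj₁ i<n  = allBelow⁻ P n t′ i i<n
... | Pn , _  | inj₂ refl = Pn

allBelow-true : ∀ P n → allBelow P n ≡ true → ∀ i → i < n → T (P i)
allBelow-true P n eq = allBelow⁻ P n (from T-≡ eq)

-- Comparison with unknown letters and detection of cubes

-- Positions past the end of either word count as matches, since they stand for letters of an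
-- extension not yet chosen.
agree : ℕ → Word → Word → Bool
agree zero    _       _       = true
agree (suc _) []      _       = true
agree (suc _) (_ ∷ _) []      = true
agree (suc n) (a ∷ u) (b ∷ v) = not (a xor b) ∧ agree n u v

agree⁺ : ∀ n u v → (∀ k → k < n → k < length u → k < length v → at u k ≡ at v k) → T (agree n u v)
agree⁺ zero    _       _       _ = tt
agree⁺ (suc _) []      _       _ = tt
agree⁺ (suc _) (_ ∷ _) []      _ = tt
agree⁺ (suc n) (a ∷ u) (b ∷ v) h =
  from T-∧ (same a b (h 0 z<s z<s z<s) ,
            agree⁺ n u v λ k k<n k<u k<v → h (suc k) (s≤s k<n) (s≤s k<u) (s≤s k<v))
  where
  same : ∀ a b → a ≡ b → T (not (a xor b))
  same true  _ refl = tt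
  same false _ refl = tt

agree⁻ : ∀ n u v → T (agree n u v) → ∀ k → k < n → k < length u → k < length v → at u k ≡ at v k
agree⁻ (suc n) (a ∷ u) (b ∷ v) t k k<n k<u k<v with to (T-∧ {not (a xor b)}) t
agree⁻ (suc n) (a ∷ u) (b ∷ v) t zero    _         _         _         | s , _ = same a b s
  where
  same : ∀ a b → T (not (a xor b)) → a ≡ b
  same true  true  _ = refl
  same false false _ = refl
agree⁻ (suc n) (a ∷ u) (b ∷ v) t (suc k) (s≤s k<n) (s≤s k<u) (s≤s k<v) | _ , t′ = agree⁻ n u v t′ k k<n k<u k<v

<-drop⁻ : ∀ q (w : Word) {k} → k < length (drop q w) → q + k < length w
<-drop⁻ zero    w       k<d = k<d
<-drop⁻ (suc q) (a ∷ w) k<d = s≤s (<-drop⁻ q w k<d)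

<-drop⁺ : ∀ q (w : Word) {k} → q + k < length w → k < length (drop q w)
<-drop⁺ zero    w       k<d       = k<d
<-drop⁺ (suc q) (a ∷ w) (s≤s k<d) = <-drop⁺ q w k<d

-- What a prefix still shows of a cube in an extension: the period is required only between letters
-- that are already present.
PartialCube : Word → ℕ → ℕ → Set
PartialCube w s q = ∀ k → k < q + q → s + k + q < length w → at w (s + k) ≡ at w (s + k + q)

-- Periodicity is tested by comparing `w` with itself shifted by `q`. The two bounds keep the cubes
-- that reach position `i` and fit into `B` letters.
starts : ℕ → ℕ → Word → ℕ → Bool
starts i B w q = (i <ᵇ q + (q + q)) ∧ (q + (q + q) ≤ᵇ B) ∧ agree (q + q) w (drop q w)

starts⁺ : ∀ {i B} w q → i < q + (q + q) → q + (q + q) ≤ B → PartialCube w 0 q → T (starts i B w q)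
starts⁺ {i} w q i<3q 3q≤B cube = from T-∧ (<⇒<ᵇ i<3q , from T-∧ (≤⇒≤ᵇ 3q≤B ,
  agree⁺ (q + q) w (drop q w) λ k k<2q _ k<d →
    trans (cube k k<2q (subst (_< length w) (+-comm q k) (<-drop⁻ q w k<d)))
          (trans (cong (at w) (+-comm k q)) (sym (at-drop q w k)))))

starts⁻ : ∀ {i B} w q → T (starts i B w q) → 0 < q → B ≤ length w → ContainsCube w
starts⁻ {i} {B} w q t 0<q B≤w with to (T-∧ {i <ᵇ q + (q + q)}) t
... | _ , t′ with to (T-∧ {q + (q + q) ≤ᵇ B}) t′
...   | 3q≤B , ag = initial-cube q w 0<q fits λ k k<2q →
  let q+k<w = <-≤-trans (+-monoʳ-< q k<2q) fits in
  trans (agree⁻ (q + q) w (drop q w) ag k k<2q (≤-<-trans (m≤n+m k q) q+k<w) (<-drop⁺ q w q+k<w))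
        (trans (at-drop q w k) (cong (at w) (+-comm q k)))
  where
  fits : q + (q + q) ≤ length w
  fits = ≤-trans (≤ᵇ⇒≤ _ _ 3q≤B) B≤w

-- A cube through position i in some word of length at most B that extends w: letters past the end
-- of w are unknown and match everything. For B = length w it is a cube of w itself.
through : ℕ → ℕ → Word → Bool
through zero    B w       = anyPositive (starts zero B w) (B / 3)
through (suc i) B []      = false
through (suc i) B (a ∷ w) = through i (pred B) w ∨ anyPositive (starts (suc i) B (a ∷ w)) (B / 3)

3q≤B⇒q≤B/3 : ∀ q {B} → q + (q + q) ≤ B → q ≤ B / 3
3q≤B⇒q≤B/3 q {B} 3q≤B = subst (_≤ B / 3) (m*n/n≡m q 3) (/-monoˡ-≤ 3 (subst (_≤ B) (triple q) 3q≤B))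
  where
  triple : ∀ q → q + (q + q) ≡ q * 3
  triple = solve-∀

through⁺ : ∀ s i B w q → 0 < q → s ≤ i → i < s + (q + (q + q)) → s + (q + (q + q)) ≤ B →
           i < length w → PartialCube w s q → T (through i B w)
through⁺ zero zero B w q 0<q _ i<3q 3q≤B _ cube =
  anyPositive⁺ (starts zero B w) (B / 3) 0<q (3q≤B⇒q≤B/3 q 3q≤B) (starts⁺ w q i<3q 3q≤B cube)
through⁺ zero (suc i) B (a ∷ w) q 0<q _ i<3q 3q≤B _ cube =
  from (T-∨ {through i (pred B) w}) (inj₂ (anyPositive⁺ (starts (suc i) B (a ∷ w)) (B / 3) 0<q (3q≤B⇒q≤B/3 q 3q≤B)
    (starts⁺ {suc i} {B} (a ∷ w) q i<3q 3q≤B cube)))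
through⁺ (suc s) (suc i) (suc B) (a ∷ w) q 0<q (s≤s s≤i) (s≤s i<) (s≤s ≤B) (s≤s i<w) cube =
  from T-∨ (inj₁ (through⁺ s i B w q 0<q s≤i i< ≤B i<w λ k k<2q lt → cube k k<2q (s≤s lt)))

-- As `B` does not exceed the length, no comparison runs past the end of `w`, so a detected cube is
-- genuine.
through⁻ : ∀ i B w → T (through i B w) → B ≤ length w → ContainsCube w
through⁻ zero B w t B≤w with anyPositive⁻ (starts zero B w) (B / 3) t
... | q , 0<q , st = starts⁻ w q st 0<q B≤w
through⁻ (suc i) B (a ∷ w) t B≤w with to (T-∨ {through i (pred B) w}) t
... | inj₁ t′ = prepend-cube (a ∷ []) (through⁻ i (pred B) w t′ (pred-mono-≤ B≤w))
... | inj₂ t′ with anyPositive⁻ (starts (suc i) B (a ∷ w)) (B / 3) t′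
...   | q , 0<q , st = starts⁻ {suc i} {B} (a ∷ w) q st 0<q B≤w

-- No cube with one of the first n starting positions, period at most Q and end at most B.
cubeless : ℕ → ℕ → ℕ → Word → Bool
cubeless zero    Q B w = true
cubeless (suc n) Q B w = not (anyPositive (starts zero B w) Q) ∧ cubeless n Q (pred B) (drop 1 w)

cubeless⁻ : ∀ s n Q B w q → T (cubeless n Q B w) → s < n → 0 < q → q ≤ Q →
            s + (q + (q + q)) ≤ B → ¬ PartialCube w s q
cubeless⁻ zero (suc n) Q B w q t _ 0<q q≤Q fits cube =
  T-not (proj₁ (to T-∧ t)) (anyPositive⁺ (starts zero B w) Q 0<q q≤Q
    (starts⁺ w q (<-≤-trans 0<q (m≤m+n q (q + q))) fits cube))
cubeless⁻ (suc s) (suc n) Q (suc B) w q t (s≤s s<n) 0<q q≤Q (s≤s fits) cube =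
  cubeless⁻ s n Q B (drop 1 w) q
    (proj₂ (to (T-∧ {not (anyPositive (starts zero (suc B) w) Q)}) t)) s<n 0<q q≤Q fits (shift w cube)
  where
  shift : ∀ w → PartialCube w (suc s) q → PartialCube (drop 1 w) s q
  shift []      cube k _ ()
  shift (a ∷ w) cube k k<2q lt = cube k k<2q (s≤s lt)

-- With `B = length w` this decides fragility. With larger `B` it is a necessary condition on the
-- prefixes of delicate words of length at most `B`, which is what prunes the search.
covered : ℕ → Word → Bool
covered B w = allBelow (λ i → through i B (toggle i w)) (length w)

-- Changing letter `i` of `w ++ v` creates a cube. It must pass through position `i`, for otherwise
-- it would already be a cube of the cubefree word. Restricted to `w`, it is a partial cube.
covered⁺ : ∀ {B} w v → Delicate (w ++ v) → length (w ++ v) ≤ B → T (covered B w)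
covered⁺ {B} w v del@(_ , cubefree , _) wv≤B = allBelow⁺ _ (length w) λ i i<w → letter i i<w
  where
  W = w ++ v
  letter : ∀ i → i < length w → T (through i B (toggle i w))
  letter i i<w with containsCube⇒cube (delicate⇒fragile del i (<-≤-trans i<w (subst (length w ≤_) (sym (length-++ w)) (m≤m+n _ _))))
  ... | s , q , 0<q , fits , cube = inside
    where
    fits′ : s + (q + (q + q)) ≤ length W
    fits′ = subst (_ ≤_) (length-toggle i W) fits
    sq : ∀ k → s + k + q ≡ s + (k + q)
    sq k = +-assoc s k q
    missed : (∀ j → s ≤ j → j < s + (q + (q + q)) → ¬ (j ≡ i)) → ⊥
    missed away = cubefree (cube⇒containsCube s q W 0<q fits′ λ k k<2q →
      let k+q<3q = subst (_< q + (q + q)) (+-comm q k) (+-monoʳ-< q k<2q)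
          sk<    = +-monoʳ-< s (≤-<-trans (m≤m+n k q) k+q<3q)
          skq<   = subst (_< s + (q + (q + q))) (sym (sq k)) (+-monoʳ-< s k+q<3q)
      in trans (sym (at-toggle i W (away (s + k) (m≤m+n s k) sk<)))
          (trans (cube k k<2q) (at-toggle i W (away (s + k + q) (subst (s ≤_) (sym (sq k)) (m≤m+n s _)) skq<))))
    same : ∀ k → k < length w → at (toggle i w) k ≡ at (toggle i W) k
    same k k<w = trans (sym (at-++ˡ (toggle i w) v (subst (k <_) (sym (length-toggle i w)) k<w)))
                       (cong (λ z → at z k) (sym (toggle-++ˡ i w v i<w)))
    inside : T (through i B (toggle i w))
    inside with s ≤? i | i <? s + (q + (q + q))
    ... | no s≰i | _ = ⊥-elim (missed λ { j s≤j _ refl → s≰i s≤j })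
    ... | yes _ | no i≮ = ⊥-elim (missed λ { j _ j< refl → i≮ j< })
    ... | yes s≤i | yes i< = through⁺ s i B (toggle i w) q 0<q s≤i i< (≤-trans fits′ wv≤B)
      (subst (i <_) (sym (length-toggle i w)) i<w) λ k k<2q lt →
        let lt′ = subst (s + k + q <_) (length-toggle i w) lt in
        trans (same (s + k) (≤-<-trans (m≤m+n (s + k) q) lt′))
              (trans (cube k k<2q) (sym (same (s + k + q) lt′)))

covered⁻ : ∀ w → T (covered (length w) w) → Fragile w
covered⁻ w t i i<w = through⁻ i (length w) (toggle i w)
  (allBelow⁻ (λ i → through i (length w) (toggle i w)) (length w) t i i<w) (≤-reflexive (sym (length-toggle i w)))

delicate? : Word → Bool
delicate? w = cubeless (length w) (length w / 3) (length w) w ∧ covered (length w) w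

delicate?⁻ : ∀ w → 0 < length w → T (delicate? w) → Delicate w
delicate?⁻ w 0<w t with to (T-∧ {cubeless (length w) (length w / 3) (length w) w}) t
... | cl , cv = delicate (λ { refl → n≮n 0 0<w }) cubefree (covered⁻ w cv)
  where
  cubefree : CubeFree w
  cubefree c with containsCube⇒cube c
  ... | s , q , 0<q , fits , cube =
    cubeless⁻ s (length w) (length w / 3) (length w) w q cl
      (<-≤-trans (subst (_< s + (q + (q + q))) (+-identityʳ s) (+-monoʳ-< s (<-≤-trans 0<q (m≤m+n q (q + q))))) fits)
      0<q (3q≤B⇒q≤B/3 q (m+n≤o⇒n≤o s fits)) fits λ k k<2q _ → cube k k<2q

-- Delicate words of length at most 37

lengths : List ℕ
lengths = 20 ∷ 21 ∷ 22 ∷ 29 ∷ 33 ∷ 34 ∷ 35 ∷ []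

-- A certificate that every delicate extension of `w` by at most `f` letters, of total length at
-- most 37, has a listed length. Either `w` is discarded, or `w` itself is harmless and both
-- continuations are certified.
explore : ℕ → Word → Bool
branch : ℕ → Word → Bool

explore f w =
  -- Shorter prefixes have been tested before, so only cubes through the last letter are sought.
  through (pred (length w)) (length w) w ∨ not (covered 37 w) ∨
  ((⌊ length w ∈? lengths ⌋ ∨ not (covered (length w) w)) ∧ branch f w)

branch zero    w = true
branch (suc f) w = explore f (w ∷ʳ false) ∧ explore f (w ∷ʳ true)

-- A cube in the prefix `w` persists in `w ++ v`, and an uncovered `w` contradicts `covered⁺`. If
-- `v` is empty, `covered⁺` with the exact length as bound leaves only membership in the list.
explore⁻ : ∀ f w v → T (explore f w) → length v ≤ f → length (w ++ v) ≤ 37 →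
           Delicate (w ++ v) → length (w ++ v) ∈ lengths
branch⁻ : ∀ f w a v → T (branch f w) → length (a ∷ v) ≤ f → length (w ++ a ∷ v) ≤ 37 →
          Delicate (w ++ a ∷ v) → length (w ++ a ∷ v) ∈ lengths

explore⁻ f w v t v≤f ≤37 del with to (T-∨ {through (pred (length w)) (length w) w}) t
... | inj₁ thr = ⊥-elim (proj₁ (proj₂ del) (append-cube v (through⁻ (pred (length w)) (length w) w thr ≤-refl)))
... | inj₂ t₁ with to (T-∨ {not (covered 37 w)}) t₁
...   | inj₁ ncov = ⊥-elim (T-not ncov (covered⁺ w v del ≤37))
...   | inj₂ t₂ with to (T-∧ {⌊ length w ∈? lengths ⌋ ∨ not (covered (length w) w)}) t₂
explore⁻ f w (a ∷ v) t v≤f ≤37 del | inj₂ _ | inj₂ _ | _ , br = branch⁻ f w a v br v≤f ≤37 del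
explore⁻ f w [] t v≤f ≤37 del | inj₂ _ | inj₂ _ | leaf , _ with to (T-∨ {⌊ length w ∈? lengths ⌋}) leaf
... | inj₁ member = subst (_∈ lengths) (cong length (sym (++-identityʳ w))) (toWitness member)
... | inj₂ ncov   = ⊥-elim (T-not ncov (covered⁺ w [] del (≤-reflexive (cong length (++-identityʳ w)))))

branch⁻ (suc f) w a v t (s≤s v≤f) ≤37 del = subst (λ z → length z ∈ lengths) eq
  (explore⁻ f (w ∷ʳ a) v (child a (to T-∧ t)) v≤f (subst (λ z → length z ≤ 37) (sym eq) ≤37) (subst Delicate (sym eq) del))
  where
  eq : (w ∷ʳ a) ++ v ≡ w ++ a ∷ v
  eq = ++-assoc w (a ∷ []) v
  child : ∀ a → T (explore f (w ∷ʳ false)) × T (explore f (w ∷ʳ true)) → T (explore f (w ∷ʳ a))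
  child false (t₀ , _) = t₀
  child true  (_ , t₁) = t₁

-- 49 is the character code of the digit 1.
word : String → Word
word s = map (λ c → primCharToNat c ≡ᵇ 49) (toList s)

-- The morphism

h₀ : Word
h₀ = word "0110101100101100101001"

block : Bool → Word
block b = map (_xor b) h₀

morph : Word → Word
morph []      = []
morph (a ∷ w) = block a ++ morph w

length-block : ∀ b → length (block b) ≡ 22
length-block b = refl

at-morph-head : ∀ a w k → k < 22 → at (morph (a ∷ w)) k ≡ at (block a) k
at-morph-head a w k k<22 = at-++ˡ (block a) (morph w) (subst (k <_) (sym (length-block a)) k<22)

at-morph-tail : ∀ a w k → at (morph (a ∷ w)) (22 + k) ≡ at (morph w) k
at-morph-tail a w k = trans (cong (λ n → at (morph (a ∷ w)) (n + k)) (sym (length-block a))) (at-++ʳ (block a) (morph w) k)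

-- The fixed point of the morphism

-- The sum modulo 2 of the letters of `h₀` at the base-22 digits of `n`. As `h₀` begins with 0,
-- leading zero digits contribute nothing, so any fuel of at least `n` gives the same value.
τ-fuel : ℕ → ℕ → Bool
τ-fuel zero    n = false
τ-fuel (suc f) n = at h₀ (n % 22) xor τ-fuel f (n / 22)

-- Opaque, since τ (22 + n) would otherwise unfold during conversion checking.
opaque
  τ : ℕ → Bool
  τ n = τ-fuel n n

  τ-fuel-0 : ∀ f → τ-fuel f 0 ≡ false
  τ-fuel-0 zero    = refl
  τ-fuel-0 (suc f) = τ-fuel-0 f

  τ-fuel-stable : ∀ f n → n ≤ f → τ-fuel f n ≡ τ n
  τ-fuel-stable f n n≤f = stable f n n n≤f ≤-refl
    where
    stable : ∀ f g n → n ≤ f → n ≤ g → τ-fuel f n ≡ τ-fuel g n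
    stable f       g       zero    _   _   = trans (τ-fuel-0 f) (sym (τ-fuel-0 g))
    stable (suc f) (suc g) (suc n) n≤f n≤g = cong (at h₀ (suc n % 22) xor_)
      (stable f g (suc n / 22) (s≤s⁻¹ (<-≤-trans smaller n≤f)) (s≤s⁻¹ (<-≤-trans smaller n≤g)))
      where
      smaller : suc n / 22 < suc n
      smaller = m/n<m (suc n) 22 (s≤s (s≤s z≤n))

  τ-step : ∀ n → τ n ≡ at h₀ (n % 22) xor τ (n / 22)
  τ-step zero    = refl
  τ-step (suc n) = cong (at h₀ (suc n % 22) xor_)
    (τ-fuel-stable n (suc n / 22) (s≤s⁻¹ (m/n<m (suc n) 22 (s≤s (s≤s z≤n)))))

-- This is the fixed-point equation: `r` is the last base-22 digit of the position and `j` is the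
-- number formed by the others.
τ-digit : ∀ r j → r < 22 → τ (r + j * 22) ≡ at h₀ r xor τ j
τ-digit r j r<22 = trans (τ-step (r + j * 22)) (cong₂ (λ x y → at h₀ x xor τ y)
  (trans ([m+kn]%n≡m%n r j 22) (m<n⇒m%n≡m r<22))
  (trans (+-distrib-/-∣ʳ r (n∣m*n j {22})) (cong₂ _+_ (m<n⇒m/n≡0 r<22) (m*n/n≡m j 22))))

at-block : ∀ b r → r < 22 → at (block b) r ≡ at h₀ r xor b
at-block b r r<22 = at-map h₀ r r<22
  where
  at-map : ∀ w k → k < length w → at (map (_xor b) w) k ≡ at w k xor b
  at-map (a ∷ w) zero    _         = refl
  at-map (a ∷ w) (suc k) (s≤s k<w) = at-map w k k<w

τ-factor : ℕ → ℕ → Word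
τ-factor j zero    = []
τ-factor j (suc n) = τ j ∷ τ-factor (suc j) n

length-τ-factor : ∀ j n → length (τ-factor j n) ≡ n
length-τ-factor j zero    = refl
length-τ-factor j (suc n) = cong suc (length-τ-factor (suc j) n)

length-morph : ∀ w → length (morph w) ≡ length w * 22
length-morph []      = refl
length-morph (a ∷ w) = trans (length-++ (block a) {morph w}) (cong (22 +_) (length-morph w))

-- Reduces questions about a stretch of `τ` to the image of a short word, where they become finite
-- checks.
at-morph-τ : ∀ j n k → k < n * 22 → at (morph (τ-factor j n)) k ≡ τ (k + j * 22)
at-morph-τ j zero    k ()
at-morph-τ j (suc n) k k< with k <? 22
... | yes k<22 = trans (at-morph-head (τ j) (τ-factor (suc j) n) k k<22) (trans (at-block (τ j) k k<22) (sym (τ-digit k j k<22)))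
... | no  k≮22 = subst (λ m → at (morph (τ-factor j (suc n))) m ≡ τ (m + j * 22)) 22+l≡k
  (trans (at-morph-tail (τ j) (τ-factor (suc j) n) l)
    (trans (at-morph-τ (suc j) n l (+-cancelˡ-< 22 l (n * 22) (subst (_< suc n * 22) (sym 22+l≡k) k<))) (cong τ (rearrange l j))))
  where
  l = k ∸ 22
  22+l≡k : 22 + l ≡ k
  22+l≡k = m+[n∸m]≡n (≮⇒≥ k≮22)
  rearrange : ∀ l j → l + (22 + j * 22) ≡ 22 + l + j * 22
  rearrange = solve-∀

-- Alignment of blocks and cubefreeness of the fixed point

every : ℕ → (Word → Bool) → Bool
every zero    P = P []
every (suc n) P = every n (λ w → P (false ∷ w)) ∧ every n (λ w → P (true ∷ w))

every⁻ : ∀ n P → every n P ≡ true → ∀ w → length w ≡ n → T (P w)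
every⁻ n P all w refl = go w P (from T-≡ all)
  where
  go : ∀ w P → T (every (length w) P) → T (P w)
  go []          P t = t
  go (false ∷ w) P t = go w (λ w → P (false ∷ w)) (proj₁ (to T-∧ t))
  go (true ∷ w)  P t = go w (λ w → P (true ∷ w)) (proj₂ (to (T-∧ {every (length w) (λ w → P (false ∷ w))}) t))

-- For `w` of length 3, the first block is sought at offset `ρ` within the two blocks that follow
-- it. The first letter need not be adjacent to the other two in `τ`: it only names the block
-- sought.
matchesAt : Word → ℕ → Bool
matchesAt w ρ = agree 22 (morph w) (drop (22 + ρ) (morph w))

unaligned : Word → Bool
unaligned w = not (anyPositive (matchesAt w) 21)

no-unaligned : every 3 unaligned ≡ true
no-unaligned = refl

-- The shifted copy of block `b` begins at offset `q % 22` of block `b + q / 22`. A nonzero offset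
-- would place it across two consecutive blocks, which `no-unaligned` excludes.
synchronised : ∀ b q → (∀ k → k < 22 → τ (k + b * 22) ≡ τ (k + b * 22 + q)) → q ≡ q / 22 * 22
synchronised b q match with q % 22 in eq
... | zero  = trans (m≡m%n+[m/n]*n q 22) (cong (_+ q / 22 * 22) eq)
... | suc ρ′ = ⊥-elim (T-not (every⁻ 3 unaligned no-unaligned w refl)
    (anyPositive⁺ (matchesAt w) 21 z<s ρ≤21 (agree⁺ 22 (morph w) (drop (22 + ρ) (morph w)) λ k k<22 _ _ → begin
      at (morph w) k                 ≡⟨ at-morph-head (τ b) (τ-factor (b + q / 22) 2) k k<22 ⟩
      at (block (τ b)) k             ≡⟨ at-block (τ b) k k<22 ⟩
      at h₀ k xor τ b                ≡⟨ sym (τ-digit k b k<22) ⟩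
      τ (k + b * 22)                 ≡⟨ match k k<22 ⟩
      τ (k + b * 22 + q)             ≡⟨ cong τ (trans (cong (k + b * 22 +_) q≡) (rearrange k b ρ (q / 22))) ⟩
      τ (ρ + k + (b + q / 22) * 22)  ≡⟨ sym (at-morph-τ (b + q / 22) 2 (ρ + k) (+-mono-≤-< {ρ} {22} (≤-trans ρ≤21 (n≤1+n 21)) k<22)) ⟩
      at (morph (τ-factor (b + q / 22) 2)) (ρ + k) ≡⟨ sym (at-morph-tail (τ b) (τ-factor (b + q / 22) 2) (ρ + k)) ⟩
      at (morph w) (22 + (ρ + k))    ≡⟨ sym (at-drop (22 + ρ) (morph w) k) ⟩
      at (drop (22 + ρ) (morph w)) k ∎)))
  where
  open ≡-Reasoning
  ρ = suc ρ′
  ρ≤21 : ρ ≤ 21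
  ρ≤21 = subst (_≤ 21) eq (s≤s⁻¹ (m%n<n q 22))
  w : Word
  w = τ b ∷ τ-factor (b + q / 22) 2
  q≡ : q ≡ ρ + q / 22 * 22
  q≡ = trans (m≡m%n+[m/n]*n q 22) (cong (_+ q / 22 * 22) eq)
  rearrange : ∀ k b ρ c → k + b * 22 + (ρ + c * 22) ≡ ρ + k + (b + c) * 22
  rearrange = solve-∀

-- A cube of period at most 21 that starts in the first block ends within 21 + 63 = 84 letters,
-- hence within four blocks.
no-short-cube : every 4 (λ w → cubeless 22 21 88 (morph w)) ≡ true
no-short-cube = refl

xor-cancelˡ : ∀ a {b c} → a xor b ≡ a xor c → b ≡ c
xor-cancelˡ a {b} {c} eq = trans (sym (undo b)) (trans (cong (a xor_) eq) (undo c))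
  where
  undo : ∀ b → a xor (a xor b) ≡ b
  undo b = trans (sym (xor-assoc a a b)) (cong (_xor b) (xor-same a))

-- Well-founded descent on the period: a short cube fits in four blocks, and a long one yields a
-- cube of period `q / 22`.
τ-cubefree : ∀ q → Acc _<_ q → ∀ s → 0 < q → ¬ Cube τ s q
τ-cubefree q (acc rec) s 0<q cube with q <? 22
... | yes (s≤s q≤21) = cubeless⁻ r 22 21 88 (morph w) q (every⁻ 4 (λ w → cubeless 22 21 88 (morph w)) no-short-cube w refl) r<22 0<q q≤21 fits
    λ k k<2q _ → trans (letter k (<-≤-trans k<2q (m≤n+m (q + q) q)))
      (trans (cube k k<2q) (sym (trans (cong (at (morph w)) (+-assoc r k q))
        (trans (letter (k + q) (subst (_< q + (q + q)) (+-comm q k) (+-monoʳ-< q k<2q))) (cong τ (sym (+-assoc s k q)))))))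
  where
  r = s % 22
  j = s / 22
  w : Word
  w = τ-factor j 4
  r<22 : r < 22
  r<22 = m%n<n s 22
  fits : r + (q + (q + q)) ≤ 88
  fits = ≤-trans (+-mono-≤ (s≤s⁻¹ r<22) (+-mono-≤ q≤21 (+-mono-≤ q≤21 q≤21))) (m≤m+n 84 4)
  letter : ∀ k → k < q + (q + q) → at (morph w) (r + k) ≡ τ (s + k)
  letter k k<3q = trans (at-morph-τ j 4 (r + k) (<-≤-trans (+-monoʳ-< r k<3q) fits))
    (cong τ (trans (rearrange r k (j * 22)) (cong (_+ k) (sym (m≡m%n+[m/n]*n s 22)))))
    where
    rearrange : ∀ r k m → r + k + m ≡ r + m + k
    rearrange = solve-∀
-- The cube is sampled at the positions `s + l * 22`. They all have the last digit `r`, so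
-- cancelling `at h₀ r` leaves letters of `τ` one level up.
... | no q≮22 = τ-cubefree q′ (rec q′<q) j 0<q′ λ l l<2q′ → xor-cancelˡ (at h₀ r) (begin
    at h₀ r xor τ (j + l)         ≡⟨ sym (τ-digit r (j + l) r<22) ⟩
    τ (r + (j + l) * 22)          ≡⟨ cong τ (trans (rearrange₁ r j l) (cong (_+ l * 22) (sym s≡))) ⟩
    τ (s + l * 22)                ≡⟨ cube (l * 22) (subst (l * 22 <_) (sym 2q≡) (*-monoˡ-< 22 l<2q′)) ⟩
    τ (s + l * 22 + q)            ≡⟨ cong τ (trans (cong₂ (λ x y → x + l * 22 + y) s≡ q≡) (rearrange₂ r j l q′)) ⟩
    τ (r + (j + l + q′) * 22)     ≡⟨ τ-digit r (j + l + q′) r<22 ⟩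
    at h₀ r xor τ (j + l + q′)    ∎)
  where
  open ≡-Reasoning
  r = s % 22
  j = s / 22
  q′ = q / 22
  r<22 : r < 22
  r<22 = m%n<n s 22
  s≡ : s ≡ r + j * 22
  s≡ = m≡m%n+[m/n]*n s 22
  q≥22 : 22 ≤ q
  q≥22 = ≮⇒≥ q≮22
  -- Block j + 1 starts 22 - r letters after s, so it lies within the first two periods.
  d = 22 ∸ r
  r+d≡22 : r + d ≡ 22
  r+d≡22 = m+[n∸m]≡n (<⇒≤ r<22)
  q≡ : q ≡ q′ * 22
  q≡ = synchronised (suc j) q λ k k<22 →
    let pos : s + (d + k) ≡ k + suc j * 22
        pos = trans (cong (_+ (d + k)) s≡) (trans (rearrange₀ r d k (j * 22)) (cong (λ z → k + (z + j * 22)) r+d≡22))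
    in trans (cong τ (sym pos)) (trans (cube (d + k) (+-mono-≤-< (≤-trans (m∸n≤m 22 r) q≥22) (<-≤-trans k<22 q≥22)))
         (cong (λ z → τ (z + q)) pos))
    where
    rearrange₀ : ∀ r d k m → r + m + (d + k) ≡ k + (r + d + m)
    rearrange₀ = solve-∀
  2q≡ : q + q ≡ (q′ + q′) * 22
  2q≡ = trans (cong₂ _+_ q≡ q≡) (sym (*-distribʳ-+ 22 q′ q′))
  instance
    q-nonZero : NonZero q
    q-nonZero = >-nonZero 0<q
  q′<q : q′ < q
  q′<q = m/n<m q 22 (s≤s (s≤s z≤n))
  0<q′ : 0 < q′
  0<q′ = m≥n⇒m/n>0 q≥22
  rearrange₁ : ∀ r j l → r + (j + l) * 22 ≡ r + j * 22 + l * 22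
  rearrange₁ = solve-∀
  rearrange₂ : ∀ r j l c → r + j * 22 + l * 22 + c * 22 ≡ r + (j + l + c) * 22
  rearrange₂ = solve-∀

-- Stems continued by blocks of the fixed point

opaque
  unfolding τ

  -- The first letter identifies block 0 as `h₀`; the other six name the blocks used in the finite
  -- check of stems.
  τ-start : τ-factor 0 7 ≡ false ∷ true ∷ true ∷ false ∷ true ∷ false ∷ true ∷ []
  τ-start = refl

τ-0 : τ 0 ≡ false
τ-0 = cong (λ w → at w 0) τ-start

-- The last four letters of h₀, followed by blocks.
ending : Word → Word
ending w = true ∷ false ∷ false ∷ true ∷ morph w

length-ending : ∀ m → length (ending (τ-factor 1 m)) ≡ 4 + m * 22
length-ending m = cong (4 +_) (trans (length-morph (τ-factor 1 m)) (cong (_* 22) (length-τ-factor 1 m)))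

-- Block 0 is `h₀`, so the letters 1001 are its positions 18 to 21, and the ending continues as `τ`
-- itself.
at-ending : ∀ m k → k < 4 + m * 22 → at (ending (τ-factor 1 m)) k ≡ τ (18 + k)
at-ending m k k< = begin
  at (ending (τ-factor 1 m)) k                 ≡⟨ cong (λ b → at (drop 18 (morph (b ∷ τ-factor 1 m))) k) (sym τ-0) ⟩
  at (drop 18 (morph (τ-factor 0 (suc m)))) k  ≡⟨ at-drop 18 (morph (τ-factor 0 (suc m))) k ⟩
  at (morph (τ-factor 0 (suc m))) (18 + k)     ≡⟨ at-morph-τ 0 (suc m) (18 + k) (+-monoʳ-< 18 k<) ⟩
  τ (18 + k + 0)                               ≡⟨ cong τ (+-identityʳ (18 + k)) ⟩
  τ (18 + k)                                   ∎
  where open ≡-Reasoning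

fragile-morph : ∀ w → Fragile (morph w)
fragile-morph []      i ()
fragile-morph (a ∷ w) = fragile-++ (fragile-block a) (fragile-morph w)
  where
  fragile-block : ∀ a → Fragile (block a)
  fragile-block false = covered⁻ (block false) tt
  fragile-block true  = covered⁻ (block true) tt

-- The letters 1001 serve twice: with `e` they form the fragile word to which blocks are appended,
-- and with the blocks they form a factor of `τ`.
extension : Word → ℕ → Word
extension e m = e ++ ending (τ-factor 1 m)

length-extension : ∀ e m → length (extension e m) ≡ length e + (4 + m * 22)
length-extension e m = trans (length-++ e) (cong (length e +_) (length-ending m))

extension-fragile : ∀ e m → Fragile (e ++ ending []) → Fragile (extension e m)
extension-fragile e m fr = subst Fragile (++-assoc e (ending []) (morph (τ-factor 1 m)))
  (fragile-++ fr (fragile-morph (τ-factor 1 m)))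

at-extension-head : ∀ e m {k} → k < length e → at (extension e m) k ≡ at e k
at-extension-head e m = at-++ˡ e (ending (τ-factor 1 m))

at-extension-τ : ∀ e m k → length e + k < length (extension e m) →
                 at (extension e m) (length e + k) ≡ τ (18 + k)
at-extension-τ e m k lt = trans (at-++ʳ e (ending (τ-factor 1 m)) k)
  (at-ending m k (+-cancelˡ-< (length e) k _ (subst (length e + k <_) (length-extension e m) lt)))

-- Transfers the finite check at six blocks to any number of blocks.
at-extension : ∀ e m n k → k < length (extension e m) → k < length (extension e n) →
               at (extension e m) k ≡ at (extension e n) k
at-extension e m n k k<m k<n with k <? length e
... | yes k<e = trans (at-extension-head e m k<e) (sym (at-extension-head e n k<e))
... | no  k≮e = subst (λ k → at (extension e m) k ≡ at (extension e n) k) eq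
  (trans (at-extension-τ e m l (subst (_< length (extension e m)) (sym eq) k<m))
    (sym (at-extension-τ e n l (subst (_< length (extension e n)) (sym eq) k<n))))
  where
  l = k ∸ length e
  eq : length e + l ≡ k
  eq = m+[n∸m]≡n (≮⇒≥ k≮e)

-- Stems give `length e = 41 + r` with `r` at most 21, whence the bound 62. The final 1 of `e`
-- differs from the 0 that precedes 1001 in `h₀`, so the junction breaks the pattern of `τ`.
module _ (x : Word) (m : ℕ) (d≤62 : length (x ∷ʳ true) ≤ 62) where

  private
    e = x ∷ʳ true
    d = length e
    W = extension e m

  -- Such a cube lies wholly in the part copied from `τ`.
  no-late-cube : ∀ s q → 0 < q → d ≤ s → s + (q + (q + q)) ≤ length W → ¬ Cube (at W) s q
  no-late-cube s q 0<q d≤s fits cube = τ-cubefree q (<-wellFounded q) (18 + l) 0<q λ k k<2q →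
    let k+q<3q = subst (_< q + (q + q)) (+-comm q k) (+-monoʳ-< q k<2q) in
    trans (sym (letter k (≤-<-trans (m≤m+n k q) k+q<3q)))
    (trans (cube k k<2q)
    (trans (cong (at W) (+-assoc s k q))
    (trans (letter (k + q) k+q<3q) (cong τ (sym (+-assoc (18 + l) k q))))))
    where
    l = s ∸ d
    letter : ∀ k → k < q + (q + q) → at W (s + k) ≡ τ (18 + l + k)
    letter k k<3q = trans (cong (at W) pos) (at-extension-τ e m (l + k)
      (subst (_< length W) pos (<-≤-trans (+-monoʳ-< s k<3q) fits)))
      where
      pos : s + k ≡ d + (l + k)
      pos = trans (cong (_+ k) (sym (m+[n∸m]≡n d≤s))) (+-assoc d l k)

  -- A long period moves the junction (1, then 1001, then a block) into the τ part, where blocks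
  -- are aligned and the letters 5 places and 1 place before a block differ.
  no-early-long-cube : ∀ s q → s < d → 44 ≤ q → s + (q + (q + q)) ≤ length W → ¬ Cube (at W) s q
  no-early-long-cube s q@(suc q₁) s<d 44≤q fits cube = clash (τ c) before₅ before₁
    where
    open ≡-Reasoning
    c = q / 22
    d≡ : d ≡ suc (length x)
    d≡ = trans (length-++ x) (+-comm (length x) 1)
    -- Here 88 = 62 + 26 = 44 + 44: the stem, the letters 1001 and one whole block lie within two
    -- periods of the start of the cube.
    repeats : ∀ i → s ≤ i → i < 88 → at W i ≡ at W (i + q) × i + q < length W
    repeats i s≤i i<88 =
      subst (λ i → at W i ≡ at W (i + q)) (m+[n∸m]≡n s≤i) (cube (i ∸ s) k<2q) ,
      <-≤-trans (subst (_< s + (q + (q + q))) i+q≡ (+-monoʳ-< s (+-monoʳ-< q k<2q))) fits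
      where
      k<2q : i ∸ s < q + q
      k<2q = ≤-<-trans (m∸n≤m i s) (<-≤-trans i<88 (+-mono-≤ 44≤q 44≤q))
      i+q≡ : s + (q + (i ∸ s)) ≡ i + q
      i+q≡ = trans (trans (cong (s +_) (+-comm q (i ∸ s))) (sym (+-assoc s (i ∸ s) q)))
               (cong (_+ q) (m+[n∸m]≡n s≤i))
    τ-repeats : ∀ k → k < 26 → τ (18 + k) ≡ τ (18 + k + q)
    τ-repeats k k<26 with repeats (d + k) (≤-trans (<⇒≤ s<d) (m≤m+n d k)) (+-mono-≤-< d≤62 k<26)
    ... | eq , d+k+q<W = begin
      τ (18 + k)        ≡⟨ sym (at-extension-τ e m k (≤-<-trans (m≤m+n (d + k) q) d+k+q<W)) ⟩
      at W (d + k)      ≡⟨ eq ⟩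
      at W (d + k + q)  ≡⟨ cong (at W) (+-assoc d k q) ⟩
      at W (d + (k + q)) ≡⟨ at-extension-τ e m (k + q) (subst (_< length W) (+-assoc d k q) d+k+q<W) ⟩
      τ (18 + (k + q))  ≡⟨ cong τ (sym (+-assoc 18 k q)) ⟩
      τ (18 + k + q)    ∎
    q≡ : q ≡ c * 22
    q≡ = synchronised 1 q λ k k<22 →
      subst (λ i → τ i ≡ τ (i + q)) (+-comm 22 k) (τ-repeats (4 + k) (+-monoʳ-< 4 k<22))
    before₁ : true ≡ true xor τ c
    before₁ = begin
      true             ≡⟨ cong (true xor_) (sym τ-0) ⟩
      true xor τ 0     ≡⟨ sym (τ-digit 21 0 (m≤m+n 22 0)) ⟩
      τ 21             ≡⟨ τ-repeats 3 (m≤m+n 4 22) ⟩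
      τ (21 + q)       ≡⟨ cong (λ q → τ (21 + q)) q≡ ⟩
      τ (21 + c * 22)  ≡⟨ τ-digit 21 c (m≤m+n 22 0) ⟩
      true xor τ c     ∎
    last-repeats : at W (length x) ≡ at W (length x + q) × length x + q < length W
    last-repeats = repeats (length x) (s≤s⁻¹ (subst (s <_) d≡ s<d))
      (<-≤-trans (subst (length x <_) (sym d≡) (n<1+n (length x))) (≤-trans d≤62 (m≤m+n 62 26)))
    x+q≡ : length x + q ≡ d + q₁
    x+q≡ = trans (+-suc (length x) q₁) (cong (_+ q₁) (sym d≡))
    before₅ : true ≡ false xor τ c
    before₅ = begin
      true                  ≡⟨ sym (at-++ʳ x (true ∷ []) 0) ⟩
      at e (length x + 0)   ≡⟨ cong (at e) (+-identityʳ (length x)) ⟩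
      at e (length x)       ≡⟨ sym (at-extension-head e m (subst (length x <_) (sym d≡) (n<1+n (length x)))) ⟩
      at W (length x)       ≡⟨ proj₁ last-repeats ⟩
      at W (length x + q)   ≡⟨ cong (at W) x+q≡ ⟩
      at W (d + q₁)         ≡⟨ at-extension-τ e m q₁ (subst (_< length W) x+q≡ (proj₂ last-repeats)) ⟩
      τ (17 + q)            ≡⟨ cong (λ q → τ (17 + q)) q≡ ⟩
      τ (17 + c * 22)       ≡⟨ τ-digit 17 c (m≤m+n 18 4) ⟩
      false xor τ c         ∎
    clash : ∀ b → true ≡ false xor b → true ≡ true xor b → ⊥
    clash true  _  ()
    clash false () _

  -- Three periods span at most 129 letters, and `extension e 6` has 136 = 4 + 6 * 22 letters after
  -- `e`. So every cube of this kind would already be visible there.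
  no-early-short-cube : T (cubeless d 43 (d + 136) (extension e 6)) →
    ∀ s q → 0 < q → s < d → q ≤ 43 → s + (q + (q + q)) ≤ length W → ¬ Cube (at W) s q
  no-early-short-cube t s q 0<q s<d q≤43 fits cube =
    cubeless⁻ s d 43 (d + 136) (extension e 6) q t s<d 0<q q≤43 fits₆ λ k k<2q lt →
      let skq<W = <-≤-trans (subst (_< s + (q + (q + q))) (trans (cong (s +_) (+-comm q k)) (sym (+-assoc s k q)))
                    (+-monoʳ-< s (+-monoʳ-< q k<2q))) fits in
      trans (at-extension e 6 m (s + k) (≤-<-trans (m≤m+n (s + k) q) lt) (≤-<-trans (m≤m+n (s + k) q) skq<W))
        (trans (cube k k<2q) (at-extension e m 6 (s + k + q) skq<W lt))
    where
    fits₆ : s + (q + (q + q)) ≤ d + 136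
    fits₆ = +-mono-≤ (<⇒≤ s<d) (≤-trans (+-mono-≤ q≤43 (+-mono-≤ q≤43 q≤43)) (m≤m+n 129 7))

  extension-cubefree : T (cubeless d 43 (d + 136) (extension e 6)) → CubeFree W
  extension-cubefree t c with containsCube⇒cube c
  ... | s , q , 0<q , fits , cube with s <? d | q <? 44
  ...   | no  s≮d | _              = no-late-cube s q 0<q (≮⇒≥ s≮d) fits cube
  ...   | yes s<d | no  q≮44       = no-early-long-cube s q s<d (≮⇒≥ q≮44) fits cube
  ...   | yes s<d | yes (s≤s q≤43) = no-early-short-cube t s q 0<q s<d q≤43 fits cube

-- Explicit words

entry : List String → ℕ → Word
entry []       _       = []
entry (s ∷ _)  zero    = word s
entry (_ ∷ ss) (suc i) = entry ss i

-- Entry r followed by 11001 is a delicate word of length 45 + r.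
stems : List String
stems =
  "1101011001011001010010110011001001100110" ∷
  "11010110010110010100110110011001001100110" ∷
  "001010011010011010110010110011001001100110" ∷
  "1001010011010011010110010110011001001100110" ∷
  "00101001101001101011010010110011001001100110" ∷
  "001010011010011010110100110110011001001100110" ∷
  "1101011001011001010010110010110011001001100110" ∷
  "11010110010110010100101100110110011001001100110" ∷
  "001010011010011010110010100110110011001001100110" ∷
  "0010100110100110101101100100110110011001001100110" ∷
  "01101011001011001010011010110010110011001001100110" ∷
  "110101100101100101001100101100110110011001001100110" ∷
  "1101011001011001010010110100110010110011001001100110" ∷
  "00101001101001101011011001001100110110011001001100110" ∷
  "100101001101001101011001011001010010110011001001100110" ∷
  "1001010011010011010110101100101100110110011001001100110" ∷
  "10011011001100100110011011001001100110110011001001100110" ∷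
  "110101100101100101001101001101011010010110011001001100110" ∷
  "0010100110100110101100101100101001100110110011001001100110" ∷
  "10011011001100100110011011001100100110010110011001001100110" ∷
  "011001001100110110011001001100110100110011010011001001100110" ∷
  "1101011001011001010011010011001001101100110110011001001100110" ∷ []

isStem : ℕ → Bool
isStem r = let e = entry stems r ∷ʳ true in
  (length e ≡ᵇ 41 + r) ∧
  -- The six letters are `τ 1` to `τ 6`, written out so that the check evaluates although `τ` is
  -- opaque.
  cubeless (length e) 43 (length e + 136) (e ++ ending (true ∷ true ∷ false ∷ true ∷ false ∷ true ∷ [])) ∧
  covered (length (e ++ ending [])) (e ++ ending [])

stems-checked : allBelow isStem 22 ≡ true
stems-checked = refl

long-delicate : ∀ r m → r < 22 → ∃[ w ] (Delicate w × length w ≡ 45 + (r + m * 22))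
long-delicate r m r<22 = extension e m , delicate (nonempty e (τ-factor 1 m)) cubefree fragile ,
    trans (length-extension e m) (trans (cong (_+ (4 + m * 22)) |e|) (rearrange r m))
  where
  x = entry stems r
  e = x ∷ʳ true
  checks : T (length e ≡ᵇ 41 + r) ×
           T (cubeless (length e) 43 (length e + 136) (e ++ ending (true ∷ true ∷ false ∷ true ∷ false ∷ true ∷ [])) ∧
              covered (length (e ++ ending [])) (e ++ ending []))
  checks = to (T-∧ {length e ≡ᵇ 41 + r}) (allBelow-true isStem 22 stems-checked r r<22)
  checks₂ : T (cubeless (length e) 43 (length e + 136) (e ++ ending (true ∷ true ∷ false ∷ true ∷ false ∷ true ∷ []))) ×
            T (covered (length (e ++ ending [])) (e ++ ending []))
  checks₂ = to T-∧ (proj₂ checks)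
  |e| : length e ≡ 41 + r
  |e| = ≡ᵇ⇒≡ (length e) (41 + r) (proj₁ checks)
  cubefree : CubeFree (extension e m)
  cubefree = extension-cubefree x m (subst (_≤ 62) (sym |e|) (+-monoʳ-≤ 41 (s≤s⁻¹ r<22)))
    -- `τ-start` without its first letter identifies the six literal letters with `τ-factor 1 6`.
    (subst (λ w → T (cubeless (length e) 43 (length e + 136) (e ++ ending w))) (sym (cong (drop 1) τ-start)) (proj₁ checks₂))
  fragile : Fragile (extension e m)
  fragile = extension-fragile e m (covered⁻ (e ++ ending []) (proj₂ checks₂))
  nonempty : ∀ u v → ¬ (u ++ ending v ≡ [])
  nonempty []      _ ()
  nonempty (_ ∷ _) _ ()
  rearrange : ∀ r m → 41 + r + (4 + m * 22) ≡ 45 + (r + m * 22)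
  rearrange = solve-∀

-- Entry i has length 38 + i.
middle : List String
middle =
  "10011011001100100110011011001100100110" ∷
  "110101100101100101001010011010011010110" ∷
  "1001010011010011010110101100101100101001" ∷
  "10011011001100100110011010110010110010100" ∷
  "011010110010110010100110011011001100100110" ∷
  "0110101100101100101001100101001101001101011" ∷
  "10010100110100110101100110101100101100101001" ∷ []

isMiddle : ℕ → Bool
isMiddle i = (length (entry middle i) ≡ᵇ 38 + i) ∧ delicate? (entry middle i)

middle-checked : allBelow isMiddle 7 ≡ true
middle-checked = refl

middle-delicate : ∀ i → i < 7 → ∃[ w ] (Delicate w × length w ≡ 38 + i)
middle-delicate i i<7 = w , delicate?⁻ w (subst (0 <_) (sym |w|) z<s) (proj₂ checks) , |w|
  where
  w = entry middle i
  checks : T (length w ≡ᵇ 38 + i) × T (delicate? w)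
  checks = to T-∧ (allBelow-true isMiddle 7 middle-checked i i<7)
  |w| : length w ≡ 38 + i
  |w| = ≡ᵇ⇒≡ (length w) (38 + i) (proj₁ checks)

-- Words of all the admissible lengths

≥38-delicate : ∀ n → 38 ≤ n → ∃[ w ] (Delicate w × length w ≡ n)
≥38-delicate n 38≤n with n <? 45
... | yes n<45 = subst (λ n → ∃[ w ] (Delicate w × length w ≡ n)) eq
    (middle-delicate (n ∸ 38) (+-cancelˡ-< 38 (n ∸ 38) 7 (subst (_< 45) (sym eq) n<45)))
  where
  eq : 38 + (n ∸ 38) ≡ n
  eq = m+[n∸m]≡n 38≤n
-- The remainder of `n ∸ 45` modulo 22 selects the stem, and the quotient is the number of blocks.
... | no n≮45 = subst (λ n → ∃[ w ] (Delicate w × length w ≡ n))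
    (trans (cong (45 +_) (sym (m≡m%n+[m/n]*n (n ∸ 45) 22))) (m+[n∸m]≡n (≮⇒≥ n≮45)))
    (long-delicate ((n ∸ 45) % 22) ((n ∸ 45) / 22) (m%n<n (n ∸ 45) 22))

explicit : ∀ s → 0 < length (word s) → delicate? (word s) ≡ true →
           ∃[ w ] (Delicate w × length w ≡ length (word s))
explicit s 0<w t = word s , delicate?⁻ (word s) 0<w (from T-≡ t) , refl

short-delicate : ∀ {n} → n ∈ lengths → ∃[ w ] (Delicate w × length w ≡ n)
short-delicate (here refl) = explicit "00101001101001101011" z<s refl
short-delicate (there (here refl)) = explicit "001010011010011010110" z<s refl
short-delicate (there (there (here refl))) = explicit "0110101100101100101001" z<s refl
short-delicate (there (there (there (here refl)))) = explicit "01100100110011011001100100110" z<s refl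
short-delicate (there (there (there (there (here refl))))) = explicit "110101100101100101001101001101011" z<s refl
short-delicate (there (there (there (there (there (here refl)))))) = explicit "1101011001011001010011010011010110" z<s refl
short-delicate (there (there (there (there (there (there (here refl))))))) = explicit "10010100110100110101100101100101001" z<s refl

branch-true : ∀ f w a v → branch f w ≡ true → length (a ∷ v) ≤ f → length (w ++ a ∷ v) ≤ 37 →
              Delicate (w ++ a ∷ v) → length (w ++ a ∷ v) ∈ lengths
branch-true f w a v eq = branch⁻ f w a v (from T-≡ eq)

-- Stated with ≡ true because evaluating T (branch 37 []) is several times slower.
explored : branch 37 [] ≡ true
explored = refl

short⇒lengths : ∀ w → Delicate w → length w ≤ 37 → length w ∈ lengths
short⇒lengths []      (ne , _) _   = ⊥-elim (ne refl)
-- The search starts with `branch`: `explore` would fail on the empty word, which is vacuously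
-- covered and has an unlisted length.
short⇒lengths (a ∷ w) del      ≤37 = branch-true 37 [] a w explored ≤37 ≤37 del

theorem5 : (n : ℕ) →
    (∃[ w ] (Delicate w × length w ≡ n))
      ⇔ (n ≡ 20 ⊎ n ≡ 21 ⊎ n ≡ 22 ⊎ n ≡ 29 ⊎ n ≡ 33 ⊎ n ≡ 34 ⊎ n ≡ 35 ⊎ n ≥ 38)
theorem5 n = mk⇔ necessary sufficient
  where
  necessary : ∃[ w ] (Delicate w × length w ≡ n) → _
  necessary (w , del , refl) with length w ≤? 37
  ... | no  ≰37 = inj₂ (inj₂ (inj₂ (inj₂ (inj₂ (inj₂ (inj₂ (≰⇒> ≰37)))))))
  ... | yes ≤37 = member (short⇒lengths w del ≤37)
    where
    member : ∀ {n} → n ∈ lengths → n ≡ 20 ⊎ n ≡ 21 ⊎ n ≡ 22 ⊎ n ≡ 29 ⊎ n ≡ 33 ⊎ n ≡ 34 ⊎ n ≡ 35 ⊎ n ≥ 38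
    member (here p) = inj₁ p
    member (there (here p)) = inj₂ (inj₁ p)
    member (there (there (here p))) = inj₂ (inj₂ (inj₁ p))
    member (there (there (there (here p)))) = inj₂ (inj₂ (inj₂ (inj₁ p)))
    member (there (there (there (there (here p))))) = inj₂ (inj₂ (inj₂ (inj₂ (inj₁ p))))
    member (there (there (there (there (there (here p)))))) = inj₂ (inj₂ (inj₂ (inj₂ (inj₂ (inj₁ p)))))
    member (there (there (there (there (there (there (here p))))))) =
      inj₂ (inj₂ (inj₂ (inj₂ (inj₂ (inj₂ (inj₁ p))))))
  sufficient : _ → ∃[ w ] (Delicate w × length w ≡ n)
  sufficient (inj₁ refl) = short-delicate (here refl)
  sufficient (inj₂ (inj₁ refl)) = short-delicate (there (here refl))
  sufficient (inj₂ (inj₂ (inj₁ refl))) = short-delicate (there (there (here refl)))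
  sufficient (inj₂ (inj₂ (inj₂ (inj₁ refl)))) = short-delicate (there (there (there (here refl))))
  sufficient (inj₂ (inj₂ (inj₂ (inj₂ (inj₁ refl))))) = short-delicate (there (there (there (there (here refl)))))
  sufficient (inj₂ (inj₂ (inj₂ (inj₂ (inj₂ (inj₁ refl)))))) = short-delicate (there (there (there (there (there (here refl))))))
  sufficient (inj₂ (inj₂ (inj₂ (inj₂ (inj₂ (inj₂ (inj₁ refl))))))) =
    short-delicate (there (there (there (there (there (there (here refl)))))))
  sufficient (inj₂ (inj₂ (inj₂ (inj₂ (inj₂ (inj₂ (inj₂ ≥38))))))) = ≥38-delicate n ≥38
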